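{- Let $l\ge2$ be an integer, let $w\ge 2$ be an even integer, let $u=(1,1,\dots,1)\in\mathbf R^w$ (row vector) and $\rho=\left\lfloor\frac{l-1}{2}\right\rfloor$. Then: (i) the number of brick-wall lattice paths of the first type is $\mathcal B^{(1)}_{l,w}=u\,b^{(1)}_{l-1}$, where $$b^{(1)}_{l-1}=\begin{cases}(M_+M_-)^{\rho}\,b_0, & l\text{ odd},\\ M_-(M_+M_-)^{\rho}\,b_0, & l\text{ even};\end{cases}$$ (ii) the number of brick-wall lattice paths of the second type is $\mathcal B^{(2)}_{l,w}=u\,b^{(2)}_{l-1}$, where $$b^{(2)}_{l-1}=\begin{cases}(M_-M_+)^{\rho}\,b_0, & l\text{ odd},\\ M_+(M_-M_+)^{\rho}\,b_0, & l\text{ even}.\end{cases}$$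
   Context: A point $(a,b)\in\mathbf Z\times\mathbf Z$ is even (odd) if $|a|+|b|$ is even (odd). A brick-wall lattice path of the first type is a finite sequence of points of $\mathbf Z\times\mathbf Z$ in which each consecutive step is either the horizontal step $(1,0)$ (allowed from any point), or the step $(0,1)$ taken from an even point, or the step $(0,-1)$ taken from an odd point. A brick-wall lattice path of the second type is defined in the same way with the steps $(1,0)$ from any point, $(0,1)$ from an odd point, $(0,-1)$ from an even point. Paths visit no point more than once; the empty path (a single point) is allowed. Let $\mathcal R=[0,l-1]\times[0,w-1]$. For $t\in\{1,2\}$, $\mathcal B^{(t)}_{l,w}$ is the number of brick-wall lattice paths of type $t$ (type 1 = first, type 2 = second) starting at some point $(0,\alpha)$ and ending at some point $(l-1,\beta)$, with $\alpha,\beta\in\{0,\dots,w-1\}$, staying inside $\mathcal R$ and using no vertical step along the left side $x=0$ (vertical steps along the right side $x=l-1$ are allowed). For $0\le i\le l-1$, $0\le j\le w-1$, $b^{(t)}_{ij}$ is the number of such paths of type $t$ (inside $\mathcal R$, starting on the left side, no vertical step along $x=0$) ending at $(i,j)$, and $b^{(t)}_i$ is the column vector $(b^{(t)}_{i,w-1},b^{(t)}_{i,w-2},\dots,b^{(t)}_{i,1},b^{(t)}_{i,0})^T$. In particular $b^{(1)}_0=b^{(2)}_0=b_0$ is the all-ones column vector. Let $J=\begin{pmatrix}1&1\\1&1\end{pmatrix}$. For even $w$, $M_-$ and $M_+$ are the $w\times w$ block-diagonal matrices $M_-=\mathrm{diag}(1,J,\dots,J,1)$ (with $(w-2)/2$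 blocks $J$ and $1\times1$ blocks $(1)$ at both ends) and $M_+=\mathrm{diag}(J,J,\dots,J)$ (with $w/2$ blocks $J$). -}

module Defs where

open import Algebra.Properties.Semiring.Sum as SemiringSum using ()
open import Data.Fin.Base using (Fin; zero; suc; toℕ; cast; splitAt; opposite)
import Data.Fin.Properties as Fin
open import Data.Integer.Base as ℤ using (ℤ; +_; 0ℤ; 1ℤ; ∣_∣)
import Data.Integer.Properties as ℤ
open import Data.List.Base as List using (List; []; _∷_; _++_; upTo; cartesianProductWith; filter)
import Data.List.Properties as List
open import Data.List.Membership.Propositional using (_∈_)
import Data.List.Membership.Propositional.Properties as ∈
open import Data.List.NonEmpty.Base using (List⁺; _∷_; toList; head; last)
open import Data.List.Relation.Unary.All as All using (All; []; _∷_)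
open import Data.List.Relation.Unary.AllPairs as AllPairs using ([]; _∷_)
open import Data.List.Relation.Unary.Any as Any using (here; there)
open import Data.List.Relation.Unary.Linked as Linked using (Linked)
open import Data.List.Relation.Unary.Unique.Propositional using (Unique)
import Data.List.Relation.Unary.Unique.Propositional.Properties as Unique
open import Data.Nat.Base as ℕ using (ℕ; zero; suc; z≤n; s≤s)
open import Data.Nat.Divisibility using (_∣_; _∣?_; divides)
open import Data.Nat.DivMod using (_/_; m*n/n≡m)
import Data.Nat.Properties as ℕ
open import Data.Product using (∃; ∃-syntax; _×_; _,_; proj₁; proj₂; uncurry)
import Data.Product.Properties as Product
open import Data.Sum using (_⊎_; inj₁; inj₂)
open import Data.Vec.Functional using (Vector; replicate)
open import Relation.Binary.PropositionalEquality
  using (_≡_; _≢_; refl; sym; trans; cong; subst; module ≡-Reasoning)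
open import Relation.Nullary using (¬_; Dec; ¬?; contradiction)
open import Relation.Nullary.Decidable using (map′; _×-dec_; _⊎-dec_; _→-dec_)
open import Relation.Unary using (Decidable)

open SemiringSum ℕ.+-*-semiring using (sum)

------------------------------------------------------------------------
-- Cardinality of a finite set of objects.  Only the objects are counted,
-- not the proofs that they satisfy the predicate.

record Finite {A : Set} (P : A → Set) : Set where
  field
    elements : List A
    unique   : Unique elements
    sound    : ∀ {x} → x ∈ elements → P x
    complete : ∀ {x} → P x → x ∈ elements

card : {A : Set} {P : A → Set} → Finite P → ℕ
card F = List.length (Finite.elements F)

------------------------------------------------------------------------
-- Brick-wall lattice paths

Point : Set
Point = ℤ × ℤ

EvenPoint OddPoint : Point → Set
EvenPoint (a , b) = 2 ∣ ∣ a ∣ ℕ.+ ∣ b ∣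
OddPoint p = ¬ EvenPoint p

data PathType : Set where
  first second : PathType

UpFrom DownFrom : PathType → Point → Set
UpFrom   first  = EvenPoint
UpFrom   second = OddPoint
DownFrom first  = OddPoint
DownFrom second = EvenPoint

Horizontal : Point → Point → Set
Horizontal (a , b) q = q ≡ (a ℤ.+ 1ℤ , b)

Vertical : PathType → Point → Point → Set
Vertical t p@(a , b) q =
  (UpFrom t p × q ≡ (a , b ℤ.+ 1ℤ)) ⊎ (DownFrom t p × q ≡ (a , b ℤ.- 1ℤ))

Step : PathType → Point → Point → Set
Step t p q = Horizontal p q ⊎ Vertical t p q

record IsBrickWallPath (t : PathType) (π : List⁺ Point) : Set where
  constructor brickWallPath
  field
    steps     : Linked (Step t) (toList π)
    no-repeat : Unique (toList π)

InRectangle : ℕ → ℕ → Point → Set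
InRectangle l w (a , b) =
  (0ℤ ℤ.≤ a × a ℤ.≤ + l ℤ.- 1ℤ) × (0ℤ ℤ.≤ b × b ℤ.≤ + w ℤ.- 1ℤ)

record Admissible (t : PathType) (l w : ℕ) (π : List⁺ Point) : Set where
  constructor admissible
  field
    isPath           : IsBrickWallPath t π
    inside           : All (InRectangle l w) (toList π)
    startsLeft       : ∃[ α ] head π ≡ (0ℤ , + toℕ {w} α)
    noVerticalOnLeft : Linked (λ p q → Vertical t p q → proj₁ p ≢ 0ℤ) (toList π)

PathTo : PathType → (l w i j : ℕ) → List⁺ Point → Set
PathTo t l w i j π = Admissible t l w π × last π ≡ (+ i , + j)

CrossingPath : PathType → (l w : ℕ) → List⁺ Point → Set
CrossingPath t l w π =
  Admissible t l w π × ∃[ β ] last π ≡ (+ (l ℕ.∸ 1) , + toℕ {w} β)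

------------------------------------------------------------------------
-- Finiteness: a path without repeated points inside the rectangle has at
-- most as many points as the rectangle.

_≟ₚ_ : (p q : Point) → Dec (p ≡ q)
_≟ₚ_ = Product.≡-dec ℤ._≟_ ℤ._≟_

upFrom? : ∀ t → Decidable (UpFrom t)
upFrom? first  (a , b) = 2 ∣? _
upFrom? second (a , b) = ¬? (2 ∣? _)

downFrom? : ∀ t → Decidable (DownFrom t)
downFrom? first  (a , b) = ¬? (2 ∣? _)
downFrom? second (a , b) = 2 ∣? _

vertical? : ∀ t p q → Dec (Vertical t p q)
vertical? t p q =
  (upFrom? t p ×-dec (q ≟ₚ _)) ⊎-dec (downFrom? t p ×-dec (q ≟ₚ _))

step? : ∀ t p q → Dec (Step t p q)
step? t p q = (q ≟ₚ _) ⊎-dec vertical? t p q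

isBrickWallPath? : ∀ t → Decidable (IsBrickWallPath t)
isBrickWallPath? t π =
  map′ (uncurry brickWallPath)
       (λ P → IsBrickWallPath.steps P , IsBrickWallPath.no-repeat P)
       (Linked.linked? (step? t) (toList π)
         ×-dec AllPairs.allPairs? (λ p q → ¬? (p ≟ₚ q)) (toList π))

inRectangle? : ∀ l w → Decidable (InRectangle l w)
inRectangle? l w (a , b) =
  ((_ ℤ.≤? _) ×-dec (_ ℤ.≤? _)) ×-dec ((_ ℤ.≤? _) ×-dec (_ ℤ.≤? _))

admissible? : ∀ t l w → Decidable (Admissible t l w)
admissible? t l w π =
  map′ (λ (P , I , S , V) → admissible P I S V)
       (λ A → let open Admissible A in isPath , inside , startsLeft , noVerticalOnLeft)
       (isBrickWallPath? t π
         ×-dec All.all? (inRectangle? l w) (toList π)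
         ×-dec Fin.any? (λ α → head π ≟ₚ _)
         ×-dec Linked.linked? (λ p q → vertical? t p q →-dec ¬? (proj₁ p ℤ.≟ 0ℤ)) (toList π))

cells : ℕ → ℕ → List Point
cells l w = cartesianProductWith (λ a b → + a , + b) (upTo l) (upTo w)

cells-unique : ∀ l w → Unique (cells l w)
cells-unique l w =
  Unique.cartesianProductWith⁺ _ (λ { refl → refl , refl }) (Unique.upTo⁺ l) (Unique.upTo⁺ w)

∈-range : ∀ n {a} → 0ℤ ℤ.≤ a → a ℤ.≤ + n ℤ.- 1ℤ → ∃[ k ] (a ≡ + k × k ∈ upTo n)
∈-range zero    {+ k} 0≤a ()
∈-range (suc n) {+ k} 0≤a (ℤ.+≤+ k≤n) = k , refl , ∈.∈-upTo⁺ (s≤s k≤n)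

∈-cells : ∀ l w {p} → InRectangle l w p → p ∈ cells l w
∈-cells l w ((0≤a , a≤) , (0≤b , b≤))
  with k , refl , k∈ ← ∈-range l 0≤a a≤
  with m , refl , m∈ ← ∈-range w 0≤b b≤
  = ∈.∈-cartesianProductWith⁺ _ k∈ m∈

-- all lists of length at most n with entries in xs
listsUpTo : {A : Set} → List A → ℕ → List (List A)
listsUpTo xs zero    = [] ∷ []
listsUpTo xs (suc n) = [] ∷ cartesianProductWith _∷_ xs (listsUpTo xs n)

listsUpTo-unique : {A : Set} {xs : List A} → Unique xs → ∀ n → Unique (listsUpTo xs n)
listsUpTo-unique u zero    = [] ∷ []
listsUpTo-unique {xs = xs} u (suc n) =
  All.tabulate (λ { y∈ refl → ≢[] y∈ })
  ∷ Unique.cartesianProductWith⁺ _ (λ { refl → refl , refl }) u (listsUpTo-unique u n)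
  where
  ≢[] : ¬ [] ∈ cartesianProductWith _∷_ xs (listsUpTo xs n)
  ≢[] m with _ , _ , _ , _ , () ← ∈.∈-cartesianProductWith⁻ _∷_ xs (listsUpTo xs n) m

∈-listsUpTo : {A : Set} {xs : List A} → ∀ n {ys} →
              All (_∈ xs) ys → List.length ys ℕ.≤ n → ys ∈ listsUpTo xs n
∈-listsUpTo zero    []       _       = here refl
∈-listsUpTo (suc n) []       _       = here refl
∈-listsUpTo (suc n) (y ∷ ys) (s≤s p) =
  there (∈.∈-cartesianProductWith⁺ _ y (∈-listsUpTo n ys p))

length-unique-≤ : {A : Set} {xs ys : List A} →
                  Unique ys → All (_∈ xs) ys → List.length ys ℕ.≤ List.length xs
length-unique-≤ []       []        = z≤n
length-unique-≤ {A} {xs} (y∉ ∷ u) (y∈ ∷ ys∈)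
  with as , bs , refl ← ∈.∈-∃++ y∈ =
  subst (_ ℕ.≤_) (sym eq) (s≤s (length-unique-≤ u (All.tabulate avoid)))
  where
  eq : List.length (as ++ _ ∷ bs) ≡ suc (List.length (as ++ bs))
  eq = trans (List.length-++ as)
         (trans (ℕ.+-suc _ _) (cong suc (sym (List.length-++ as))))
  avoid : ∀ {z} → z ∈ _ → z ∈ as ++ bs
  avoid z∈ with ∈.∈-++⁻ as (All.lookup ys∈ z∈)
  ... | inj₁ z∈as         = ∈.∈-++⁺ˡ z∈as
  ... | inj₂ (here refl)  = contradiction refl (All.lookup y∉ z∈)
  ... | inj₂ (there z∈bs) = ∈.∈-++⁺ʳ as z∈bs

candidates : ℕ → ℕ → List (List⁺ Point)
candidates l w =
  cartesianProductWith _∷_ (cells l w) (listsUpTo (cells l w) (List.length (cells l w)))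

admissible⇒candidate : ∀ {t l w π} → Admissible t l w π → π ∈ candidates l w
admissible⇒candidate {l = l} {w} {_ ∷ _} A
  with All.map (∈-cells l w) (Admissible.inside A)
... | p∈ ∷ ps∈ =
  ∈.∈-cartesianProductWith⁺ _ p∈
    (∈-listsUpTo _ ps∈
      (ℕ.<⇒≤ (length-unique-≤ (IsBrickWallPath.no-repeat (Admissible.isPath A)) (p∈ ∷ ps∈))))

admissible-finite : ∀ t l w {Q : List⁺ Point → Set} → Decidable Q →
                    Finite (λ π → Admissible t l w π × Q π)
admissible-finite t l w {Q} Q? = record
  { elements = filter P? (candidates l w)
  ; unique   = Unique.filter⁺ P?
      (Unique.cartesianProductWith⁺ _ (λ { refl → refl , refl })
        (cells-unique l w) (listsUpTo-unique (cells-unique l w) _))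
  ; sound    = λ m → proj₂ (∈.∈-filter⁻ P? {xs = candidates l w} m)
  ; complete = λ p → ∈.∈-filter⁺ P? (admissible⇒candidate (proj₁ p)) p
  }
  where
  P? : Decidable (λ π → Admissible t l w π × Q π)
  P? π = admissible? t l w π ×-dec Q? π

pathTo-finite : ∀ t l w i j → Finite (PathTo t l w i j)
pathTo-finite t l w i j = admissible-finite t l w (λ π → last π ≟ₚ _)

crossingPath-finite : ∀ t l w → Finite (CrossingPath t l w)
crossingPath-finite t l w =
  admissible-finite t l w (λ π → Fin.any? (λ β → last π ≟ₚ _))

------------------------------------------------------------------------
-- Path counts

𝓑 : PathType → (l w : ℕ) → ℕ
𝓑 t l w = card (crossingPath-finite t l w)

bᵢⱼ : PathType → (l w i j : ℕ) → ℕ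
bᵢⱼ t l w i j = card (pathTo-finite t l w i j)

-- The entries are listed from j = w − 1 down to j = 0.
bᵢ : PathType → (l w i : ℕ) → Vector ℕ w
bᵢ t l w i k = bᵢⱼ t l w i (toℕ (opposite k))

------------------------------------------------------------------------
-- Matrices.  M₋, M₊, u and b₀ have entries 0 and 1, so the products may be
-- formed over ℕ: sums and products there agree with those in the reals.

ones : ∀ n → Vector ℕ n
ones n = replicate n 1

Matrix : ℕ → Set
Matrix n = Fin n → Fin n → ℕ

infixr 7 _·_ _·ᵛ_ _∙_
infixr 8 _^ᴹ_

_∙_ : ∀ {n} → Vector ℕ n → Vector ℕ n → ℕ
u ∙ v = sum (λ k → u k ℕ.* v k)

_·_ : ∀ {n} → Matrix n → Matrix n → Matrix n
(A · B) i j = sum (λ k → A i k ℕ.* B k j)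

_·ᵛ_ : ∀ {n} → Matrix n → Vector ℕ n → Vector ℕ n
(A ·ᵛ v) i = sum (λ k → A i k ℕ.* v k)

identity : ∀ {n} → Matrix n
identity zero    zero    = 1
identity zero    (suc _) = 0
identity (suc _) zero    = 0
identity (suc i) (suc j) = identity i j

_^ᴹ_ : ∀ {n} → Matrix n → ℕ → Matrix n
A ^ᴹ zero  = identity
A ^ᴹ suc k = A · (A ^ᴹ k)

_⊕_ : ∀ {m n} → Matrix m → Matrix n → Matrix (m ℕ.+ n)
_⊕_ {m} A B i j with splitAt m i | splitAt m j
... | inj₁ i′ | inj₁ j′ = A i′ j′
... | inj₂ i′ | inj₂ j′ = B i′ j′
... | inj₁ _  | inj₂ _  = 0
... | inj₂ _  | inj₁ _  = 0

order : List (∃ Matrix) → ℕ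
order []             = 0
order ((n , _) ∷ As) = n ℕ.+ order As

diag : (As : List (∃ Matrix)) → Matrix (order As)
diag []             = λ ()
diag ((_ , A) ∷ As) = A ⊕ diag As

castMatrix : ∀ {m n} → m ≡ n → Matrix m → Matrix n
castMatrix eq A i j = A (cast (sym eq) i) (cast (sym eq) j)

J : Matrix 2
J _ _ = 1

𝟏 : Matrix 1
𝟏 _ _ = 1

M₊-blocks M₋-blocks : ℕ → List (∃ Matrix)
M₊-blocks w = List.replicate (w / 2) (2 , J)
M₋-blocks w = (1 , 𝟏) ∷ List.replicate ((w ℕ.∸ 2) / 2) (2 , J) ++ (1 , 𝟏) ∷ []

order-replicate-J : ∀ k As → order (List.replicate k (2 , J) ++ As) ≡ k ℕ.* 2 ℕ.+ order As
order-replicate-J zero    As = refl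
order-replicate-J (suc k) As = cong (2 ℕ.+_) (order-replicate-J k As)

M₊-order : ∀ {w} → 2 ∣ w → order (M₊-blocks w) ≡ w
M₊-order (divides q refl) = begin
  order (List.replicate (q ℕ.* 2 / 2) (2 , J))  ≡⟨ cong (λ k → order (List.replicate k (2 , J))) (m*n/n≡m q 2) ⟩
  order (List.replicate q (2 , J))              ≡⟨ cong order (List.++-identityʳ (List.replicate q (2 , J))) ⟨
  order (List.replicate q (2 , J) ++ [])        ≡⟨ order-replicate-J q [] ⟩
  q ℕ.* 2 ℕ.+ 0                           ≡⟨ ℕ.+-identityʳ _ ⟩
  q ℕ.* 2                                 ∎
  where open ≡-Reasoning

M₋-order : ∀ {w} → 2 ℕ.≤ w → 2 ∣ w → order (M₋-blocks w) ≡ w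
M₋-order _ (divides (suc q) refl) = cong suc (begin
  order (List.replicate (q ℕ.* 2 / 2) (2 , J) ++ (1 , 𝟏) ∷ [])  ≡⟨ order-replicate-J (q ℕ.* 2 / 2) _ ⟩
  q ℕ.* 2 / 2 ℕ.* 2 ℕ.+ 1                           ≡⟨ cong (λ k → k ℕ.* 2 ℕ.+ 1) (m*n/n≡m q 2) ⟩
  q ℕ.* 2 ℕ.+ 1                                     ≡⟨ ℕ.+-comm _ 1 ⟩
  suc (q ℕ.* 2)                                     ∎)
  where open ≡-Reasoning

M₊ : ∀ w → 2 ∣ w → Matrix w
M₊ w 2∣w = castMatrix (M₊-order 2∣w) (diag (M₊-blocks w))

M₋ : ∀ w → 2 ℕ.≤ w → 2 ∣ w → Matrix w
M₋ w 2≤w 2∣w = castMatrix (M₋-order 2≤w 2∣w) (diag (M₋-blocks w))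

{-# OPTIONS --safe #-}
module Submission where

-- Abscissae never decrease along a path, and in the column x = a the vertical
-- edges form a matching: type 1 joins b to b + 1 when a + b is even, type 2 when
-- a + b is odd.  So two distinct heights b, c are matched iff
-- ⌊ (s + a + b) / 2 ⌋ = ⌊ (s + a + c) / 2 ⌋, where s = 0 for type 1 and s = 1 for
-- type 2.  A path without repeated points uses at most one vertical edge per
-- column, hence b_{i+1} = T b_i, where T_{bc} = 1 if these floors agree and 0
-- otherwise.  T depends only on the parity of s + a.  As w is even, listing the
-- heights from the top preserves both matchings, and T is M₊ or M₋ according to
-- whether s + a is even or odd.

open import Data.Bool.Base using (if_then_else_)
open import Data.Fin.Base using (Fin; zero; suc; toℕ; fromℕ<; opposite)
import Data.Fin.Properties as Fin
open import Data.Integer.Base as ℤ using (+_; 0ℤ; 1ℤ)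
import Data.Integer.Properties as ℤ
open import Data.List.Base as List using (List; []; _∷_; _++_; concat; tabulate)
open import Data.List.Membership.Propositional using (_∈_; _∉_)
import Data.List.Membership.Propositional.Properties as ∈
open import Data.List.NonEmpty.Base using (List⁺; _∷_; toList; last; _⁺∷ʳ_; snocView; _∷ʳ′_)
import Data.List.Properties as List
open import Data.List.Relation.Unary.All as All using (All; []; _∷_)
import Data.List.Relation.Unary.All.Properties as All
open import Data.List.Relation.Unary.AllPairs using ([]; _∷_)
import Data.List.Relation.Unary.AllPairs.Properties as AllPairs
open import Data.List.Relation.Unary.Any using (here; there)
open import Data.List.Relation.Unary.Linked as Linked using (Linked; [-]; _∷_)
open import Data.List.Relation.Unary.Unique.Propositional using (Unique)
import Data.List.Relation.Unary.Unique.Propositional.Properties as Unique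
open import Data.Nat using (ℕ; zero; suc; _+_; _*_; _≤_; _<_; _∸_; ⌊_/2⌋; z≤n; s≤s)
open import Data.Nat.DivMod using (_/_)
open import Data.Nat.Divisibility using (_∣_; _∣?_; divides; ∣-refl; ∣m∣n⇒∣m+n; ∣m+n∣m⇒∣n)
import Data.Nat.Properties as ℕ
open import Data.Product using (∃-syntax; _×_; _,_; proj₁; proj₂)
open import Data.Sum using (_⊎_; inj₁; inj₂)
open import Data.Unit.Base using (tt)
open import Data.Vec.Functional using (Vector)
open import Function.Base using (_∘_; id)
open import Level using (0ℓ)
open import Relation.Binary.Core using (Rel)
open import Relation.Binary.Definitions using (Reflexive; Transitive)
open import Relation.Binary.PropositionalEquality
  using (_≡_; _≢_; _≗_; refl; sym; trans; cong; cong₂; subst; module ≡-Reasoning)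
open import Relation.Nullary using (¬_; Dec; yes; no; does; contradiction)
open import Relation.Unary using (Decidable)
open import Defs
open import Algebra.Properties.Semiring.Sum ℕ.+-*-semiring
  using (sum; sum-cong-≗; sum-replicate-zero; *-distribˡ-sum; *-distribʳ-sum; ∑-comm)

private variable
  A B P Q : Set

-- Counting finite sets

indicator : Dec P → ℕ
indicator P? = if does P? then 1 else 0

indicator-cong : (P? : Dec P) (Q? : Dec Q) → (P → Q) → (Q → P) → indicator P? ≡ indicator Q?
indicator-cong (yes p) (yes q) f g = refl
indicator-cong (yes p) (no ¬q) f g = contradiction (f p) ¬q
indicator-cong (no ¬p) (yes q) f g = contradiction (g q) ¬p
indicator-cong (no ¬p) (no ¬q) f g = refl

-- Each of two duplicate-free lists with the same members is at most as long as the other, by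
-- `length-unique-≤`. So a count may be computed from any convenient enumeration.
card-unique : {P : A → Set} (F : Finite P) {xs : List A} → Unique xs →
              (∀ {x} → x ∈ xs → P x) → (∀ {x} → P x → x ∈ xs) →
              card F ≡ List.length xs
card-unique F u sound complete = ℕ.≤-antisym
  (length-unique-≤ (Finite.unique F) (All.tabulate (complete ∘ Finite.sound F)))
  (length-unique-≤ u (All.tabulate (Finite.complete F ∘ sound)))

length-concat-tabulate : ∀ {n} (xss : Fin n → List A) →
                         List.length (concat (tabulate xss)) ≡ sum (List.length ∘ xss)
length-concat-tabulate {n = zero}  xss = refl
length-concat-tabulate {n = suc n} xss =
  trans (List.length-++ (xss zero)) (cong (λ n → List.length (xss zero) + n) (length-concat-tabulate (xss ∘ suc)))

-- Injectivity is asked on the members of `xs` only, because `extend` is shown to be injective only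
-- on genuine paths.
unique-map : {f : A → B} {xs : List A} → Unique xs →
             (∀ {x y} → x ∈ xs → y ∈ xs → f x ≡ f y → x ≡ y) → Unique (List.map f xs)
unique-map []       inj = []
unique-map (x∉ ∷ u) inj =
  All.map⁺ (All.tabulate λ y∈ eq → All.lookup x∉ y∈ (inj (here refl) (there y∈) eq))
  ∷ unique-map u (λ x∈ y∈ → inj (there x∈) (there y∈))

-- The objects are split into disjoint injective images, one for each `k` satisfying `R`. Writing
-- the selection of `k` as a 0-1 factor gives the count the shape of a matrix row times a vector.
card-sum : ∀ {n} {P : A → Set} {Q : Fin n → B → Set} {R : Fin n → Set}
           (F : Finite P) (G : ∀ k → Finite (Q k)) (R? : Decidable R) (f : Fin n → B → A) →
           (∀ {k x} → R k → Q k x → P (f k x)) →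
           (∀ {z} → P z → ∃[ k ] ∃[ x ] R k × Q k x × z ≡ f k x) →
           (∀ {k k′ x y} → Q k x → Q k′ y → f k x ≡ f k′ y → k ≡ k′ × x ≡ y) →
           card F ≡ sum (λ k → indicator (R? k) * card (G k))
card-sum {A = A} {n = n} {P} {Q} {R} F G R? f sound complete injective =
  trans (card-unique F unique-xs sound-xs complete-xs)
    (trans (length-concat-tabulate images) (sum-cong-≗ length-images))
  where
  images : Fin n → List A
  images k = if does (R? k) then List.map (f k) (Finite.elements (G k)) else []

  length-images : ∀ k → List.length (images k) ≡ indicator (R? k) * card (G k)
  length-images k with R? k
  ... | yes _ = trans (List.length-map (f k) (Finite.elements (G k))) (sym (ℕ.+-identityʳ _))
  ... | no  _ = refl

  ∈-images⁻ : ∀ k {z} → z ∈ images k → ∃[ x ] R k × Q k x × z ≡ f k x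
  ∈-images⁻ k z∈ with yes r ← R? k with x , x∈ , eq ← ∈.∈-map⁻ (f k) z∈ =
    x , r , Finite.sound (G k) x∈ , eq

  unique-images : ∀ k → Unique (images k)
  unique-images k with R? k
  ... | yes _ = unique-map (Finite.unique (G k)) λ x∈ y∈ →
                  proj₂ ∘ injective (Finite.sound (G k) x∈) (Finite.sound (G k) y∈)
  ... | no  _ = []

  xs : List A
  xs = concat (tabulate images)

  unique-xs : Unique xs
  unique-xs = Unique.concat⁺ (All.tabulate⁺ unique-images) (AllPairs.tabulate⁺ disjoint)
    where
    disjoint : ∀ {k k′} → k ≢ k′ → ∀ {z} → ¬ (z ∈ images k × z ∈ images k′)
    disjoint {k} {k′} k≢k′ (z∈ , z∈′)
      with _ , _ , q , refl ← ∈-images⁻ k z∈ | _ , _ , q′ , eq ← ∈-images⁻ k′ z∈′ =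
      k≢k′ (proj₁ (injective q q′ eq))

  sound-xs : ∀ {z} → z ∈ xs → P z
  sound-xs z∈
    with _ , z∈ys , ys∈ ← ∈.∈-concat⁻′ (tabulate images) z∈
    with k , refl ← ∈.∈-tabulate⁻ ys∈
    with _ , r , q , refl ← ∈-images⁻ k z∈ys = sound r q

  complete-xs : ∀ {z} → P z → z ∈ xs
  complete-xs p with k , x , r , q , refl ← complete p =
    ∈.∈-concat⁺′ ∈-images (∈.∈-tabulate⁺ k)
    where
    ∈-images : f k x ∈ images k
    ∈-images with R? k
    ... | yes _ = ∈.∈-map⁺ (f k) (Finite.complete (G k) q)
    ... | no ¬r = contradiction r ¬r

-- Appending a point to a path

last-∷ : ∀ (x y : A) ys → last (x ∷ y ∷ ys) ≡ last (y ∷ ys)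
last-∷ x y ys with List.initLast ys
... | []       = refl
... | _ List.∷ʳ′ _ = refl

last-∷ʳ : ∀ (x : A) xs y → last (x ∷ (xs List.∷ʳ y)) ≡ y
last-∷ʳ x []       y = refl
last-∷ʳ x (z ∷ zs) y = trans (last-∷ x z (zs List.∷ʳ y)) (last-∷ʳ z zs y)

last-⁺∷ʳ : ∀ (π : List⁺ A) x → last (π ⁺∷ʳ x) ≡ x
last-⁺∷ʳ (y ∷ ys) = last-∷ʳ y ys

last-∈ : ∀ (x : A) xs → last (x ∷ xs) ∈ x ∷ xs
last-∈ x []       = here refl
last-∈ x (y ∷ ys) = there (subst (_∈ y ∷ ys) (sym (last-∷ x y ys)) (last-∈ y ys))

⁺∷ʳ-injective : ∀ (π π′ : List⁺ A) {x y} → π ⁺∷ʳ x ≡ π′ ⁺∷ʳ y → π ≡ π′ × x ≡ y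
⁺∷ʳ-injective (x ∷ xs) (y ∷ ys) eq
  with refl , refl ← List.∷ʳ-injective (x ∷ xs) (y ∷ ys) (cong toList eq) = refl , refl

linked-⁺∷ʳ⁺ : {R : Rel A 0ℓ} (π : List⁺ A) {x : A} →
              Linked R (toList π) → R (last π) x → Linked R (toList (π ⁺∷ʳ x))
linked-⁺∷ʳ⁺         (y ∷ [])     [-]      r = r ∷ [-]
linked-⁺∷ʳ⁺ {R = R} (y ∷ z ∷ zs) (r′ ∷ L) r =
  r′ ∷ linked-⁺∷ʳ⁺ (z ∷ zs) L (subst (λ e → R e _) (last-∷ y z zs) r)

linked-⁺∷ʳ⁻ : {R : Rel A 0ℓ} (π : List⁺ A) {x : A} →
              Linked R (toList (π ⁺∷ʳ x)) → Linked R (toList π) × R (last π) x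
linked-⁺∷ʳ⁻         (y ∷ [])     (r ∷ [-]) = [-] , r
linked-⁺∷ʳ⁻ {R = R} (y ∷ z ∷ zs) (r ∷ L) with L′ , r′ ← linked-⁺∷ʳ⁻ (z ∷ zs) L =
  r ∷ L′ , subst (λ e → R e _) (sym (last-∷ y z zs)) r′

linked⇒all-last : {R : Rel A 0ℓ} → Reflexive R → Transitive R → (π : List⁺ A) →
                  Linked R (toList π) → All (λ x → R x (last π)) (toList π)
linked⇒all-last rfl tr (x ∷ [])     [-]     = rfl ∷ []
linked⇒all-last {R = R} rfl tr (x ∷ y ∷ ys) (r ∷ L)
  with r′ ∷ rs ← subst (λ e → All (λ z → R z e) (y ∷ ys)) (sym (last-∷ x y ys))
                   (linked⇒all-last rfl tr (y ∷ ys) L) =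
  tr r r′ ∷ r′ ∷ rs

unique-∷ʳ⁺ : ∀ {xs : List A} {x} → Unique xs → x ∉ xs → Unique (xs List.∷ʳ x)
unique-∷ʳ⁺ u x∉ = Unique.++⁺ u ([] ∷ []) λ { (x∈ , here refl) → x∉ x∈ }

unique-∷ʳ⁻ : ∀ (xs : List A) {x} → Unique (xs List.∷ʳ x) → Unique xs × x ∉ xs
unique-∷ʳ⁻ []       _        = [] , λ ()
unique-∷ʳ⁻ (y ∷ ys) (y∉ ∷ u) with u′ , x∉ ← unique-∷ʳ⁻ ys u =
  All.++⁻ˡ ys y∉ ∷ u′ ,
  λ { (here refl) → All.lookup y∉ (∈.∈-++⁺ʳ ys (here refl)) refl ; (there x∈) → x∉ x∈ }

-- Parity and halving

⌊n*2/2⌋ : ∀ n → ⌊ n * 2 /2⌋ ≡ n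
⌊n*2/2⌋ zero    = refl
⌊n*2/2⌋ (suc n) = cong suc (⌊n*2/2⌋ n)

even-suc⇒odd : ∀ {n} → 2 ∣ suc n → ¬ 2 ∣ n
even-suc⇒odd {n} 2∣1+n 2∣n with ∣m+n∣m⇒∣n (subst (2 ∣_) (ℕ.+-comm 1 n) 2∣1+n) 2∣n
... | divides zero ()
... | divides (suc _) ()

odd⇒even-suc : ∀ n → ¬ 2 ∣ n → 2 ∣ suc n
odd⇒even-suc 0             odd = contradiction (divides 0 refl) odd
odd⇒even-suc 1             odd = ∣-refl
odd⇒even-suc (suc (suc n)) odd = ∣m∣n⇒∣m+n ∣-refl (odd⇒even-suc n (odd ∘ ∣m∣n⇒∣m+n ∣-refl))

odd-suc⇒even : ∀ n → ¬ 2 ∣ suc n → 2 ∣ n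
odd-suc⇒even n odd with 2 ∣? n
... | yes 2∣n = 2∣n
... | no  2∤n = contradiction (odd⇒even-suc n 2∤n) odd

⌊1+n*2/2⌋ : ∀ n → ⌊ suc (n * 2) /2⌋ ≡ n
⌊1+n*2/2⌋ zero    = refl
⌊1+n*2/2⌋ (suc n) = cong suc (⌊1+n*2/2⌋ n)

⌊1+even/2⌋ : ∀ {n} → 2 ∣ n → ⌊ n /2⌋ ≡ ⌊ suc n /2⌋
⌊1+even/2⌋ (divides q refl) = trans (⌊n*2/2⌋ q) (sym (⌊1+n*2/2⌋ q))

-- The fibres of halving are the pairs 2k, 2k + 1. They encode the matching of heights by vertical
-- edges.
⌊/2⌋-≡ : ∀ m n → ⌊ m /2⌋ ≡ ⌊ n /2⌋ → m ≡ n ⊎ (2 ∣ m × n ≡ suc m) ⊎ (2 ∣ n × m ≡ suc n)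
⌊/2⌋-≡ 0 0 eq = inj₁ refl
⌊/2⌋-≡ 0 1 eq = inj₂ (inj₁ (divides 0 refl , refl))
⌊/2⌋-≡ 1 0 eq = inj₂ (inj₂ (divides 0 refl , refl))
⌊/2⌋-≡ 1 1 eq = inj₁ refl
⌊/2⌋-≡ (suc (suc m)) (suc (suc n)) eq with ⌊/2⌋-≡ m n (ℕ.suc-injective eq)
... | inj₁ refl               = inj₁ refl
... | inj₂ (inj₁ (e , refl)) = inj₂ (inj₁ (∣m∣n⇒∣m+n ∣-refl e , refl))
... | inj₂ (inj₂ (e , refl)) = inj₂ (inj₂ (∣m∣n⇒∣m+n ∣-refl e , refl))

-- A fibre has only two elements, so two moves within it lead back to the start. Hence two
-- consecutive vertical steps would repeat a point.
⌊/2⌋-fibre : ∀ m n o → ⌊ m /2⌋ ≡ ⌊ n /2⌋ → ⌊ n /2⌋ ≡ ⌊ o /2⌋ → m ≢ n → n ≢ o → m ≡ o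
⌊/2⌋-fibre m n o p q m≢n n≢o with ⌊/2⌋-≡ m n p | ⌊/2⌋-≡ n o q
... | inj₁ m≡n               | _                       = contradiction m≡n m≢n
... | _                      | inj₁ n≡o                = contradiction n≡o n≢o
... | inj₂ (inj₁ (e , refl)) | inj₂ (inj₁ (e′ , _))    = contradiction e (even-suc⇒odd e′)
... | inj₂ (inj₁ (_ , refl)) | inj₂ (inj₂ (_ , refl))  = refl
... | inj₂ (inj₂ (_ , refl)) | inj₂ (inj₁ (_ , refl))  = refl
... | inj₂ (inj₂ (e , refl)) | inj₂ (inj₂ (e′ , refl)) = contradiction e′ (even-suc⇒odd e)

-- Exactly one of two numbers with odd sum is odd, so rounding loses one half in total.
⌊/2⌋-complement : ∀ q {m n} → m + n ≡ suc (q * 2) → ⌊ m /2⌋ + ⌊ n /2⌋ ≡ q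
⌊/2⌋-complement zero    {0}           refl = refl
⌊/2⌋-complement (suc q) {0} {suc (suc n)} eq =
  cong suc (⌊/2⌋-complement q {0} (ℕ.suc-injective (ℕ.suc-injective eq)))
⌊/2⌋-complement zero    {1} {0}       eq = refl
⌊/2⌋-complement (suc q) {1} {suc (suc n)} eq =
  cong suc (⌊/2⌋-complement q {1} (ℕ.suc-injective (ℕ.suc-injective eq)))
⌊/2⌋-complement (suc q) {suc (suc m)} eq =
  cong suc (⌊/2⌋-complement q {m} (ℕ.suc-injective (ℕ.suc-injective eq)))

-- Steps between points of the first quadrant

⟨_,_⟩ : ℕ → ℕ → Point
⟨ a , b ⟩ = + a , + b

⟨,⟩-injective : ∀ {a b c d} → ⟨ a , b ⟩ ≡ ⟨ c , d ⟩ → a ≡ c × b ≡ d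
⟨,⟩-injective refl = refl , refl

offset : PathType → ℕ
offset first  = 0
offset second = 1

-- Equal values of edge t a at b ≢ c mean that b and c are joined by a vertical
-- edge of the column x = a.
edge : PathType → ℕ → ℕ → ℕ
edge t a b = ⌊ offset t + (a + b) /2⌋

upFrom⁺ : ∀ t {a b} → 2 ∣ offset t + (a + b) → UpFrom t ⟨ a , b ⟩
upFrom⁺ first  = id
upFrom⁺ second = even-suc⇒odd

upFrom⁻ : ∀ t {a b} → UpFrom t ⟨ a , b ⟩ → 2 ∣ offset t + (a + b)
upFrom⁻ first  = id
upFrom⁻ second = odd⇒even-suc _

-- A step down runs along an edge on which the reverse step up is allowed. Indexing by the lower end
-- `b` gives both directions the same parity condition.
downFrom⁺ : ∀ t {a b} → 2 ∣ offset t + (a + b) → DownFrom t ⟨ a , suc b ⟩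
downFrom⁺ first  {a} {b} e rewrite ℕ.+-suc a b = λ e′ → even-suc⇒odd e′ e
downFrom⁺ second {a} {b} e rewrite ℕ.+-suc a b = e

downFrom⁻ : ∀ t {a b} → DownFrom t ⟨ a , suc b ⟩ → 2 ∣ offset t + (a + b)
downFrom⁻ first  {a} {b} e rewrite ℕ.+-suc a b = odd-suc⇒even _ e
downFrom⁻ second {a} {b} e rewrite ℕ.+-suc a b = e

offset-suc : ∀ t a b → offset t + (a + suc b) ≡ suc (offset t + (a + b))
offset-suc t a b = trans (cong (λ n → offset t + n) (ℕ.+-suc a b)) (ℕ.+-suc (offset t) (a + b))

edge-suc : ∀ t {a b} → 2 ∣ offset t + (a + b) → edge t a b ≡ edge t a (suc b)
edge-suc t {a} {b} e = trans (⌊1+even/2⌋ e) (cong ⌊_/2⌋ (sym (offset-suc t a b)))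

offset-cancel : ∀ t a {b c} → offset t + (a + b) ≡ offset t + (a + c) → b ≡ c
offset-cancel t a = ℕ.+-cancelˡ-≡ a _ _ ∘ ℕ.+-cancelˡ-≡ (offset t) _ _

edge-fibre : ∀ t a b c d → edge t a b ≡ edge t a c → edge t a c ≡ edge t a d →
             b ≢ c → c ≢ d → b ≡ d
edge-fibre t a b c d p q b≢c c≢d = offset-cancel t a
  (⌊/2⌋-fibre _ (offset t + (a + c)) _ p q (b≢c ∘ offset-cancel t a) (c≢d ∘ offset-cancel t a))

horizontal⁺ : ∀ {a b} → Horizontal ⟨ a , b ⟩ ⟨ suc a , b ⟩
horizontal⁺ {a} {b} = cong (λ n → ⟨ n , b ⟩) (ℕ.+-comm 1 a)

horizontal⁻ : ∀ {a b c d} → Horizontal ⟨ a , b ⟩ ⟨ c , d ⟩ → c ≡ suc a × b ≡ d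
horizontal⁻ {a} h with c≡ , refl ← ⟨,⟩-injective h = trans c≡ (ℕ.+-comm a 1) , refl

vertical⁺ : ∀ t a {b c} → b ≢ c → edge t a b ≡ edge t a c → Vertical t ⟨ a , b ⟩ ⟨ a , c ⟩
vertical⁺ t a {b} {c} b≢c eq with ⌊/2⌋-≡ (offset t + (a + b)) (offset t + (a + c)) eq
... | inj₁ eq′ = contradiction (offset-cancel t a eq′) b≢c
... | inj₂ (inj₁ (e , eq′))
  with refl ← offset-cancel t a {c} {suc b} (trans eq′ (sym (offset-suc t a b))) =
  inj₁ (upFrom⁺ t e , cong (λ n → ⟨ a , n ⟩) (ℕ.+-comm 1 b))
... | inj₂ (inj₂ (e , eq′))
  with refl ← offset-cancel t a {b} {suc c} (trans eq′ (sym (offset-suc t a c))) =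
  inj₂ (downFrom⁺ t e , refl)

vertical⁻ : ∀ t {a b c d} → Vertical t ⟨ a , b ⟩ ⟨ c , d ⟩ →
            a ≡ c × b ≢ d × edge t a b ≡ edge t a d
vertical⁻ t {a} {b} (inj₁ (up , eq)) with refl , d≡ ← ⟨,⟩-injective eq
  with refl ← trans d≡ (ℕ.+-comm b 1) =
  refl , ℕ.m≢1+n+m b {0} , edge-suc t (upFrom⁻ t up)
vertical⁻ t {a} {suc b} (inj₂ (down , refl)) =
  refl , ℕ.m≢1+n+m b {0} ∘ sym , sym (edge-suc t (downFrom⁻ t down))

-- Paths

inRectangle⁺ : ∀ {l w a b} → a < l → b < w → InRectangle l w ⟨ a , b ⟩
inRectangle⁺ (s≤s a≤) (s≤s b≤) = (ℤ.+≤+ z≤n , ℤ.+≤+ a≤) , (ℤ.+≤+ z≤n , ℤ.+≤+ b≤)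

-- Points of a path thereby get natural coordinates, as the inversion lemmas for steps require.
inRectangle⁻ : ∀ {l w p} → InRectangle l w p → ∃[ a ] ∃[ b ] p ≡ ⟨ a , b ⟩ × a < l × b < w
inRectangle⁻ {l} {w} ((0≤a , a≤) , (0≤b , b≤))
  with a , refl , a∈ ← ∈-range l 0≤a a≤
  with b , refl , b∈ ← ∈-range w 0≤b b≤
  = a , b , refl , ∈.∈-upTo⁻ a∈ , ∈.∈-upTo⁻ b∈

module _ {t : PathType} {l w : ℕ} where

  admissible-⁺∷ʳ⁺ : ∀ π {p} → Admissible t l w π → Step t (last π) p → p ∉ toList π →
                    InRectangle l w p → (Vertical t (last π) p → proj₁ (last π) ≢ 0ℤ) →
                    Admissible t l w (π ⁺∷ʳ p)
  admissible-⁺∷ʳ⁺ π@(_ ∷ _) A step p∉ p-inside right = record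
    { isPath           = brickWallPath (linked-⁺∷ʳ⁺ π steps step) (unique-∷ʳ⁺ no-repeat p∉)
    ; inside           = All.++⁺ inside (p-inside ∷ [])
    ; startsLeft       = startsLeft
    ; noVerticalOnLeft = linked-⁺∷ʳ⁺ π noVerticalOnLeft right
    }
    where
    open Admissible A
    open IsBrickWallPath isPath

  admissible-⁺∷ʳ⁻ : ∀ π {p} → Admissible t l w (π ⁺∷ʳ p) →
                    Admissible t l w π × Step t (last π) p × p ∉ toList π ×
                    (Vertical t (last π) p → proj₁ (last π) ≢ 0ℤ)
  admissible-⁺∷ʳ⁻ π@(x ∷ xs) A =
    record
      { isPath           = brickWallPath (proj₁ L) (proj₁ U)
      ; inside           = All.++⁻ˡ (x ∷ xs) inside
      ; startsLeft       = startsLeft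
      ; noVerticalOnLeft = proj₁ N
      } , proj₂ L , proj₂ U , proj₂ N
    where
    open Admissible A
    open IsBrickWallPath isPath
    L = linked-⁺∷ʳ⁻ π steps
    U = unique-∷ʳ⁻ (x ∷ xs) no-repeat
    N = linked-⁺∷ʳ⁻ π noVerticalOnLeft

  last-inside : ∀ π → Admissible t l w π → InRectangle l w (last π)
  last-inside (x ∷ xs) A = All.lookup (Admissible.inside A) (last-∈ x xs)

  step-monotone : ∀ {p q} → Step t p q → proj₁ p ℤ.≤ proj₁ q
  step-monotone (inj₁ refl)              = ℤ.i≤i+j _ 1ℤ
  step-monotone (inj₂ (inj₁ (_ , refl))) = ℤ.≤-refl
  step-monotone (inj₂ (inj₂ (_ , refl))) = ℤ.≤-refl

  pathTo-≤ : ∀ {π i j} → PathTo t l w i j π → ∀ {p} → p ∈ toList π → proj₁ p ℤ.≤ + i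
  pathTo-≤ {π} (A , eq) p∈ =
    subst (λ q → _ ℤ.≤ proj₁ q) eq
      (All.lookup (linked⇒all-last ℤ.≤-refl ℤ.≤-trans π
        (Linked.map step-monotone (IsBrickWallPath.steps (Admissible.isPath A)))) p∈)

  -- Abscissae never decrease, so those of the path are at most `i` and the next column is still
  -- unvisited.
  pathTo-fresh : ∀ {π i j} k → PathTo t l w i j π → ⟨ suc i , k ⟩ ∉ toList π
  pathTo-fresh k P p∈ = ℕ.1+n≰n (ℤ.drop‿+≤+ (pathTo-≤ P p∈))

  pathTo-bounds : ∀ {π i j} → PathTo t l w i j π → i < l × j < w
  pathTo-bounds {π} (A , eq) with _ , _ , eq′ , i< , j< ← inRectangle⁻ (last-inside π A)
    with refl ← trans (sym eq) eq′ = i< , j<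

  horizontal-step : ∀ π {i j} → suc i < l → PathTo t l w i j π →
                    PathTo t l w (suc i) j (π ⁺∷ʳ ⟨ suc i , j ⟩)
  horizontal-step π {i} {j} 1+i<l P@(A , eq) =
    admissible-⁺∷ʳ⁺ π A (inj₁ (subst (λ p → Horizontal p _) (sym eq) horizontal⁺))
      (pathTo-fresh j P) (inRectangle⁺ 1+i<l (proj₂ (pathTo-bounds P)))
      -- The condition on the left side is vacuous: a vertical step would force `i ≡ suc i`.
      (λ v _ → ℕ.1+n≢n (sym (proj₁ (vertical⁻ t (subst (λ p → Vertical t p _) eq v)))))
    , last-⁺∷ʳ π _

  vertical-step : ∀ π {i j k} → suc i < l → k < w → j ≢ k →
                  edge t (suc i) j ≡ edge t (suc i) k → PathTo t l w i j π →
                  PathTo t l w (suc i) k (π ⁺∷ʳ ⟨ suc i , j ⟩ ⁺∷ʳ ⟨ suc i , k ⟩)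
  vertical-step π@(x ∷ xs) {i} {j} {k} 1+i<l k<w j≢k same P =
    admissible-⁺∷ʳ⁺ π′ (proj₁ P′)
      (inj₂ (subst (λ p → Vertical t p _) (sym (proj₂ P′)) (vertical⁺ t (suc i) j≢k same)))
      fresh (inRectangle⁺ 1+i<l k<w)
      (λ _ eq → contradiction (trans (sym (cong proj₁ (proj₂ P′))) eq) λ ())
    , last-⁺∷ʳ π′ _
    where
    π′ = π ⁺∷ʳ ⟨ suc i , j ⟩
    P′ = horizontal-step π 1+i<l P

    fresh : ⟨ suc i , k ⟩ ∉ toList π′
    fresh k∈ with ∈.∈-++⁻ (x ∷ xs) k∈
    ... | inj₁ k∈π         = pathTo-fresh k P k∈π
    ... | inj₂ (here refl) = j≢k refl

  -- The freshness of the final point is kept in the result; `extend-complete` needs it to exclude a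
  -- second vertical step in the column.
  pathTo-last-step : ∀ π {i k} → PathTo t l w (suc i) k π →
    ∃[ π′ ] π ≡ π′ ⁺∷ʳ ⟨ suc i , k ⟩ × ⟨ suc i , k ⟩ ∉ toList π′ ×
      (PathTo t l w i k π′ ⊎
       ∃[ j ] PathTo t l w (suc i) j π′ × j ≢ k × edge t (suc i) j ≡ edge t (suc i) k)
  pathTo-last-step π (A , eq) with snocView π
  -- A single point in the column `suc i` does not lie on the left side.
  ... | [] ∷ʳ′ p with refl ← eq | _ , () ← Admissible.startsLeft A
  pathTo-last-step π (A , eq) | (x ∷ xs) ∷ʳ′ p
    with refl ← eq
    with A′ , step , fresh , _ ← admissible-⁺∷ʳ⁻ (x ∷ xs) A
    with _ , _ , eq′ , _ ← inRectangle⁻ {l} {w} (last-inside (x ∷ xs) A′)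
    with subst (λ q → Step t q p) eq′ step
  ... | inj₁ h with refl , refl ← horizontal⁻ h = x ∷ xs , refl , fresh , inj₁ (A′ , eq′)
  ... | inj₂ v with refl , j≢k , same ← vertical⁻ t v =
    x ∷ xs , refl , fresh , inj₂ (_ , (A′ , eq′) , j≢k , same)

  -- A last step into column 0 would be either horizontal, coming from outside the rectangle, or
  -- vertical along the left side, which is forbidden.
  pathTo-zero⁻ : ∀ {π j} → PathTo t l w 0 j π → π ≡ ⟨ 0 , j ⟩ ∷ []
  pathTo-zero⁻ {π} (A , eq) with snocView π
  ... | [] ∷ʳ′ p = cong (_∷ []) eq
  ... | (x ∷ xs) ∷ʳ′ p
    with refl ← eq
    with A′ , step , _ , right ← admissible-⁺∷ʳ⁻ (x ∷ xs) A
    with _ , _ , eq′ , _ ← inRectangle⁻ {l} {w} (last-inside (x ∷ xs) A′)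
    with subst (λ q → Step t q p) eq′ step
  ... | inj₁ h with () ← proj₁ (horizontal⁻ h)
  ... | inj₂ v with refl , _ ← vertical⁻ t v =
    contradiction (cong proj₁ eq′) (right (subst (λ q → Vertical t q p) (sym eq′) v))

  pathTo-zero⁺ : ∀ {j} → 0 < l → j < w → PathTo t l w 0 j (⟨ 0 , j ⟩ ∷ [])
  pathTo-zero⁺ 0<l j<w = record
    { isPath           = brickWallPath [-] ([] ∷ [])
    ; inside           = inRectangle⁺ 0<l j<w ∷ []
    ; startsLeft       = fromℕ< j<w , cong (λ n → ⟨ 0 , n ⟩) (sym (Fin.toℕ-fromℕ< j<w))
    ; noVerticalOnLeft = [-]
    } , refl

-- Extending a path by one column

extend : ℕ → (j k : ℕ) → List⁺ Point → List⁺ Point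
extend a j k π with j ℕ.≟ k
... | yes _ = π ⁺∷ʳ ⟨ a , k ⟩
... | no  _ = π ⁺∷ʳ ⟨ a , j ⟩ ⁺∷ʳ ⟨ a , k ⟩

extend-≡ : ∀ a k π → extend a k k π ≡ π ⁺∷ʳ ⟨ a , k ⟩
extend-≡ a k π with k ℕ.≟ k
... | yes _  = refl
... | no k≢k = contradiction refl k≢k

extend-≢ : ∀ a {j k} π → j ≢ k → extend a j k π ≡ π ⁺∷ʳ ⟨ a , j ⟩ ⁺∷ʳ ⟨ a , k ⟩
extend-≢ a {j} {k} π j≢k with j ℕ.≟ k
... | yes j≡k = contradiction j≡k j≢k
... | no  _   = refl

module _ {t : PathType} {l w : ℕ} where

  extend-sound : ∀ π {i j k} → suc i < l → k < w → edge t (suc i) j ≡ edge t (suc i) k →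
                 PathTo t l w i j π → PathTo t l w (suc i) k (extend (suc i) j k π)
  extend-sound π {j = j} {k} 1+i<l k<w same P with j ℕ.≟ k
  ... | yes refl = horizontal-step π 1+i<l P
  ... | no  j≢k  = vertical-step π 1+i<l k<w j≢k same P

  -- The height `j` is the one at which the path enters the column `suc i`: it is `k` if the last
  -- step is horizontal, and otherwise the height before the single vertical step.
  extend-complete : ∀ {π i k} → PathTo t l w (suc i) k π →
                    ∃[ j ] ∃[ π′ ] edge t (suc i) j ≡ edge t (suc i) k ×
                                   PathTo t l w i j π′ × π ≡ extend (suc i) j k π′
  extend-complete {π} {i} {k} P with pathTo-last-step π P
  ... | π′ , refl , _ , inj₁ P′ = k , π′ , refl , P′ , sym (extend-≡ (suc i) k π′)
  ... | π′ , refl , fresh , inj₂ (j , P′ , j≢k , same) with pathTo-last-step π′ P′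
  ...   | π″ , refl , _ , inj₁ P″ = j , π″ , same , P″ , sym (extend-≢ (suc i) π″ j≢k)
  -- Two vertical steps in a row give `j′ ≡ k` by `edge-fibre`, so the final point is already the
  -- last point of `x ∷ xs`.
  ...   | (x ∷ xs) , refl , _ , inj₂ (j′ , P″ , j′≢j , same′)
    with refl ← edge-fibre t (suc i) j′ j k same′ same j′≢j j≢k =
    contradiction (∈.∈-++⁺ˡ (subst (_∈ x ∷ xs) (proj₂ P″) (last-∈ x xs))) fresh

  extend-injective : ∀ {π π′ i j j′} k → PathTo t l w i j π → PathTo t l w i j′ π′ →
                     extend (suc i) j k π ≡ extend (suc i) j′ k π′ → j ≡ j′ × π ≡ π′
  extend-injective {π} {π′} {i} {j} {j′} k P P′ eq with j ℕ.≟ k | j′ ℕ.≟ k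
  ... | yes refl | yes refl = refl , proj₁ (⁺∷ʳ-injective π π′ eq)
  ... | no _     | no _
    with eq′ , _ ← ⁺∷ʳ-injective (π ⁺∷ʳ _) (π′ ⁺∷ʳ _) eq
    with refl , refl ← ⁺∷ʳ-injective π π′ eq′ = refl , refl
  -- In the mixed cases one of the two paths would end both in column `i` and in column `suc i`.
  ... | yes _    | no _ with refl , _ ← ⁺∷ʳ-injective π (π′ ⁺∷ʳ _) eq
    with () ← trans (sym (proj₂ P)) (last-⁺∷ʳ π′ _)
  ... | no _     | yes _ with refl , _ ← ⁺∷ʳ-injective (π ⁺∷ʳ _) π′ eq =
    contradiction (trans (sym (proj₂ P′)) (last-⁺∷ʳ π _)) λ ()

-- Recursion for the path counts

height : ∀ {w} → Fin w → ℕ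
height = toℕ ∘ opposite

height-surjective : ∀ {w j} → j < w → ∃[ k ] j ≡ height {w} k
height-surjective j<w =
  opposite (fromℕ< j<w) ,
  sym (trans (cong toℕ (Fin.opposite-involutive (fromℕ< j<w))) (Fin.toℕ-fromℕ< j<w))

height-injective : ∀ {w} {k k′ : Fin w} → height k ≡ height k′ → k ≡ k′
height-injective {k = k} {k′} eq =
  trans (sym (Fin.opposite-involutive k))
    (trans (cong opposite (Fin.toℕ-injective eq)) (Fin.opposite-involutive k′))

-- Rows stand for the height reached in column `a`, columns for the height at which it is entered.
-- Both are read through `height` because the entries of `bᵢ` are listed from the top.
transfer : PathType → ℕ → ∀ {w} → Matrix w
transfer t a k k′ = indicator (edge t a (height k′) ℕ.≟ edge t a (height k))

bᵢ-zero : ∀ t {l w} → 0 < l → bᵢ t l w 0 ≗ ones w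
bᵢ-zero t {l} {w} 0<l k = card-unique (pathTo-finite t l w 0 (height k)) ([] ∷ [])
  (λ { (here refl) → pathTo-zero⁺ 0<l (Fin.toℕ<n (opposite k)) })
  (λ P → here (pathTo-zero⁻ P))

-- Each path into the next column is `extend` of exactly one path ending at a height that is equal
-- or matched to the final one.
bᵢ-suc : ∀ t {l w i} → suc i < l → bᵢ t l w (suc i) ≗ transfer t (suc i) ·ᵛ bᵢ t l w i
bᵢ-suc t {l} {w} {i} 1+i<l k = card-sum
  (pathTo-finite t l w (suc i) (height k)) (λ k′ → pathTo-finite t l w i (height k′))
  (λ k′ → edge t (suc i) (height k′) ℕ.≟ edge t (suc i) (height k))
  (λ k′ → extend (suc i) (height k′) (height k))
  (extend-sound _ 1+i<l (Fin.toℕ<n (opposite k)))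
  complete
  λ P P′ eq → let h , π≡ = extend-injective (height k) P P′ eq in height-injective h , π≡
  where
  complete : ∀ {π} → PathTo t l w (suc i) (height k) π →
             ∃[ k′ ] ∃[ π′ ] edge t (suc i) (height k′) ≡ edge t (suc i) (height k) ×
                             PathTo t l w i (height k′) π′ ×
                             π ≡ extend (suc i) (height k′) (height k) π′
  complete P
    with j , π′ , same , P′ , refl ← extend-complete P
    with k′ , refl ← height-surjective (proj₂ (pathTo-bounds P′)) =
    k′ , π′ , same , P′ , refl

𝓑-sum : ∀ t l w → 𝓑 t l w ≡ ones w ∙ bᵢ t l w (l ∸ 1)
𝓑-sum t l w = card-sum (crossingPath-finite t l w)
  -- Crossing paths are sorted by their final height. The condition that always holds makes every
  -- indicator 1, which is the entry of the row vector of ones.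
  (λ k → pathTo-finite t l w (l ∸ 1) (height k)) (λ _ → yes tt) (λ _ → id)
  (λ _ (A , eq) → A , _ , eq)
  (λ (A , β , eq) → let k , h = height-surjective (Fin.toℕ<n β) in
    k , _ , tt , (A , trans eq (cong (λ n → ⟨ l ∸ 1 , n ⟩) h)) , refl)
  λ { (_ , eq) (_ , eq′) refl →
      height-injective (proj₂ (⟨,⟩-injective (trans (sym eq) eq′))) , refl }

-- Transfer matrices

·ᵛ-congˡ : ∀ {n} {A B : Matrix n} → (∀ i j → A i j ≡ B i j) → ∀ v → A ·ᵛ v ≗ B ·ᵛ v
·ᵛ-congˡ A≡B v i = sum-cong-≗ λ j → cong (_* v j) (A≡B i j)

·ᵛ-congʳ : ∀ {n} (A : Matrix n) {v v′ : Vector ℕ n} → v ≗ v′ → A ·ᵛ v ≗ A ·ᵛ v′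
·ᵛ-congʳ A v≡v′ i = sum-cong-≗ λ j → cong (A i j *_) (v≡v′ j)

·-·ᵛ-assoc : ∀ {n} (A B : Matrix n) v → (A · B) ·ᵛ v ≗ A ·ᵛ B ·ᵛ v
·-·ᵛ-assoc A B v i = begin
  sum (λ j → sum (λ k → A i k * B k j) * v j)
    ≡⟨ sum-cong-≗ (λ j → *-distribʳ-sum (v j) (λ k → A i k * B k j)) ⟩
  sum (λ j → sum (λ k → A i k * B k j * v j))
    ≡⟨ ∑-comm (λ j k → A i k * B k j * v j) ⟩
  sum (λ k → sum (λ j → A i k * B k j * v j))
    ≡⟨ sum-cong-≗ (λ k → sum-cong-≗ (λ j → ℕ.*-assoc (A i k) (B k j) (v j))) ⟩
  sum (λ k → sum (λ j → A i k * (B k j * v j)))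
    ≡⟨ sum-cong-≗ (λ k → *-distribˡ-sum (A i k) (λ j → B k j * v j)) ⟨
  sum (λ k → A i k * sum (λ j → B k j * v j)) ∎
  where open ≡-Reasoning

identity-·ᵛ : ∀ {n} (v : Vector ℕ n) → identity ·ᵛ v ≗ v
identity-·ᵛ {suc n} v zero    =
  trans (cong₂ _+_ (ℕ.*-identityˡ (v zero)) (sum-replicate-zero n)) (ℕ.+-identityʳ (v zero))
identity-·ᵛ {suc n} v (suc i) = identity-·ᵛ (v ∘ suc) i

-- Entries of the block-diagonal matrices

half? : ∀ {n} (i j : Fin n) → Dec (⌊ toℕ i /2⌋ ≡ ⌊ toℕ j /2⌋)
half? i j = ⌊ toℕ i /2⌋ ℕ.≟ ⌊ toℕ j /2⌋

indicator-suc : ∀ m n → indicator (m ℕ.≟ n) ≡ indicator (suc m ℕ.≟ suc n)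
indicator-suc m n = indicator-cong (m ℕ.≟ n) (suc m ℕ.≟ suc n) (cong suc) ℕ.suc-injective

-- A leading block `J` occupies the indices 0 and 1, one fibre of halving, and shifts the rest by a
-- whole fibre. The tail `As` is empty for `M₊` and the final block `𝟏` for `M₋`.
diag-replicate-J : ∀ q As → (∀ i j → diag As i j ≡ indicator (half? i j)) →
                   ∀ i j → diag (List.replicate q (2 , J) ++ As) i j ≡ indicator (half? i j)
diag-replicate-J zero    As h i             j             = h i j
diag-replicate-J (suc q) As h zero          zero          = refl
diag-replicate-J (suc q) As h zero          (suc zero)    = refl
diag-replicate-J (suc q) As h zero          (suc (suc j)) = refl
diag-replicate-J (suc q) As h (suc zero)    zero          = refl
diag-replicate-J (suc q) As h (suc zero)    (suc zero)    = refl
diag-replicate-J (suc q) As h (suc zero)    (suc (suc j)) = refl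
diag-replicate-J (suc q) As h (suc (suc i)) zero          = refl
diag-replicate-J (suc q) As h (suc (suc i)) (suc zero)    = refl
diag-replicate-J (suc q) As h (suc (suc i)) (suc (suc j)) =
  trans (diag-replicate-J q As h i j) (indicator-suc ⌊ toℕ i /2⌋ ⌊ toℕ j /2⌋)

castMatrix-half : ∀ {m n} (eq : m ≡ n) {A : Matrix m} (s : ℕ) →
  (∀ i j → A i j ≡ indicator (⌊ s + toℕ i /2⌋ ℕ.≟ ⌊ s + toℕ j /2⌋)) →
  ∀ i j → castMatrix eq A i j ≡ indicator (⌊ s + toℕ i /2⌋ ℕ.≟ ⌊ s + toℕ j /2⌋)
castMatrix-half eq s h i j =
  trans (h _ _) (cong₂ (λ m n → indicator (⌊ s + m /2⌋ ℕ.≟ ⌊ s + n /2⌋))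
                       (Fin.toℕ-cast (sym eq) i) (Fin.toℕ-cast (sym eq) j))

M₊-entry : ∀ {w} (2∣w : 2 ∣ w) i j → M₊ w 2∣w i j ≡ indicator (half? i j)
M₊-entry {w} 2∣w = castMatrix-half (M₊-order 2∣w) 0
  (subst (λ As → ∀ i j → diag As i j ≡ indicator (half? i j))
    (List.++-identityʳ (M₊-blocks w)) (diag-replicate-J (w / 2) [] λ ()))

-- Raising indices by one leaves 1 and `w` without partners in the range from 1 to `w`, which yields
-- the two blocks `𝟏`. The indices between them pair up as 2, 3 and so on.
M₋-entry : ∀ {w} (2≤w : 2 ≤ w) (2∣w : 2 ∣ w) i j →
           M₋ w 2≤w 2∣w i j ≡ indicator (half? (suc i) (suc j))
M₋-entry {w} 2≤w 2∣w = castMatrix-half (M₋-order 2≤w 2∣w) 1 entry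
  where
  entry : ∀ i j → diag (M₋-blocks w) i j ≡ indicator (half? (suc i) (suc j))
  entry zero    zero    = refl
  entry zero    (suc j) = refl
  entry (suc i) zero    = refl
  entry (suc i) (suc j) =
    trans (diag-replicate-J ((w ∸ 2) / 2) ((1 , 𝟏) ∷ []) (λ { zero zero → refl }) i j)
          (indicator-suc ⌊ toℕ i /2⌋ ⌊ toℕ j /2⌋)

-- Reflection of heights and periodicity in the column

toℕ+height : ∀ {w} (k : Fin w) → suc (toℕ k + height k) ≡ w
toℕ+height {w} k =
  trans (cong (λ n → suc (toℕ k + n)) (Fin.opposite-prop k)) (ℕ.m+[n∸m]≡n (Fin.toℕ<n k))

-- By `⌊/2⌋-complement` the halves of `m` and `m′`, and those of `n` and `n′`, add up to `q`, so
-- reflection maps fibres to fibres.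
indicator-reflect : ∀ q {m n m′ n′} → m + m′ ≡ suc (q * 2) → n + n′ ≡ suc (q * 2) →
  indicator (⌊ n′ /2⌋ ℕ.≟ ⌊ m′ /2⌋) ≡ indicator (⌊ m /2⌋ ℕ.≟ ⌊ n /2⌋)
indicator-reflect q {m} {n} {m′} {n′} m+m′ n+n′ =
  indicator-cong (⌊ n′ /2⌋ ℕ.≟ ⌊ m′ /2⌋) (⌊ m /2⌋ ℕ.≟ ⌊ n /2⌋)
  (λ eq → ℕ.+-cancelʳ-≡ ⌊ m′ /2⌋ _ _ (trans halves (cong (λ x → ⌊ n /2⌋ + x) eq)))
  (λ eq → sym (ℕ.+-cancelˡ-≡ ⌊ m /2⌋ _ _ (trans halves (cong (_+ ⌊ n′ /2⌋) (sym eq)))))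
  where
  halves : ⌊ m /2⌋ + ⌊ m′ /2⌋ ≡ ⌊ n /2⌋ + ⌊ n′ /2⌋
  halves = trans (⌊/2⌋-complement q {m} m+m′) (sym (⌊/2⌋-complement q {n} n+n′))

reflected-M₊ : ∀ {w} (2∣w : 2 ∣ w) k k′ →
  indicator (⌊ height k′ /2⌋ ℕ.≟ ⌊ height k /2⌋) ≡ M₊ w 2∣w k k′
reflected-M₊ 2∣w@(divides (suc q) refl) k k′ =
  trans (indicator-reflect q {toℕ k} {toℕ k′} (sum-≡ k) (sum-≡ k′)) (sym (M₊-entry 2∣w k k′))
  where
  -- This sum is `w` minus 1, which is odd because `w` is even.
  sum-≡ : ∀ (k : Fin (suc q * 2)) → toℕ k + height k ≡ suc (q * 2)
  sum-≡ k = ℕ.suc-injective (toℕ+height k)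

reflected-M₋ : ∀ {w} (2≤w : 2 ≤ w) (2∣w : 2 ∣ w) k k′ →
  indicator (⌊ suc (height k′) /2⌋ ℕ.≟ ⌊ suc (height k) /2⌋) ≡ M₋ w 2≤w 2∣w k k′
reflected-M₋ 2≤w 2∣w@(divides q refl) k k′ =
  trans (indicator-reflect q {suc (toℕ k)} {suc (toℕ k′)} (sum-≡ k) (sum-≡ k′))
        (sym (M₋-entry 2≤w 2∣w k k′))
  where
  -- With both terms raised by one, the sum is `w` plus 1, again odd.
  sum-≡ : ∀ (k : Fin (q * 2)) → suc (toℕ k) + suc (height k) ≡ suc (q * 2)
  sum-≡ k = cong suc (trans (ℕ.+-suc (toℕ k) (height k)) (toℕ+height k))

-- Moving two columns to the right raises both halves by one. The split on `t` lets `offset`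
-- compute.
transfer-periodic : ∀ t a {w} (k k′ : Fin w) → transfer t (2 + a) k k′ ≡ transfer t a k k′
transfer-periodic first  a k k′ = sym (indicator-suc (edge first a (height k′)) (edge first a (height k)))
transfer-periodic second a k k′ = sym (indicator-suc (edge second a (height k′)) (edge second a (height k)))

transfer-+*2 : ∀ t a r {w} (k k′ : Fin w) → transfer t (r * 2 + a) k k′ ≡ transfer t a k k′
transfer-+*2 t a zero    k k′ = refl
transfer-+*2 t a (suc r) k k′ =
  trans (transfer-periodic t (r * 2 + a) k k′) (transfer-+*2 t a r k k′)

-- Path counts as matrix products

module _ (t : PathType) {l w : ℕ} {A B : Matrix w}
         (transfer-1 : ∀ k k′ → transfer t 1 k k′ ≡ A k k′)
         (transfer-0 : ∀ k k′ → transfer t 0 k k′ ≡ B k k′) where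

  -- Mutual induction: by periodicity `A` leads into every odd column and `B` into the columns 2, 4
  -- and so on, so two columns contribute one factor `B · A`.
  bᵢ-even : ∀ r → r * 2 < l → bᵢ t l w (r * 2) ≗ ((B · A) ^ᴹ r) ·ᵛ ones w
  bᵢ-odd  : ∀ r → suc (r * 2) < l → bᵢ t l w (suc (r * 2)) ≗ A ·ᵛ ((B · A) ^ᴹ r) ·ᵛ ones w

  bᵢ-even zero    0<l  k = trans (bᵢ-zero t 0<l k) (sym (identity-·ᵛ (ones w) k))
  bᵢ-even (suc r) 2r<l k = begin
    bᵢ t l w (suc r * 2) k                     ≡⟨ bᵢ-suc t 2r<l k ⟩
    (transfer t (suc r * 2) ·ᵛ b′) k           ≡⟨ ·ᵛ-congˡ transfer-B b′ k ⟩
    (B ·ᵛ b′) k                                ≡⟨ ·ᵛ-congʳ B (bᵢ-odd r (ℕ.<-trans (ℕ.n<1+n _) 2r<l)) k ⟩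
    (B ·ᵛ A ·ᵛ X ·ᵛ ones w) k                  ≡⟨ ·-·ᵛ-assoc B A (X ·ᵛ ones w) k ⟨
    ((B · A) ·ᵛ X ·ᵛ ones w) k                 ≡⟨ ·-·ᵛ-assoc (B · A) X (ones w) k ⟨
    (((B · A) ^ᴹ suc r) ·ᵛ ones w) k           ∎
    where
    open ≡-Reasoning
    b′ = bᵢ t l w (suc (r * 2))
    X  = (B · A) ^ᴹ r
    transfer-B : ∀ k k′ → transfer t (suc r * 2) k k′ ≡ B k k′
    transfer-B k k′ =
      trans (subst (λ a → transfer t a k k′ ≡ transfer t 0 k k′) (ℕ.+-identityʳ (suc r * 2))
              (transfer-+*2 t 0 (suc r) k k′))
            (transfer-0 k k′)

  bᵢ-odd r 1+2r<l k = begin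
    bᵢ t l w (suc (r * 2)) k                   ≡⟨ bᵢ-suc t 1+2r<l k ⟩
    (transfer t (suc (r * 2)) ·ᵛ b′) k         ≡⟨ ·ᵛ-congˡ transfer-A b′ k ⟩
    (A ·ᵛ b′) k                                ≡⟨ ·ᵛ-congʳ A (bᵢ-even r (ℕ.<-trans (ℕ.n<1+n _) 1+2r<l)) k ⟩
    (A ·ᵛ ((B · A) ^ᴹ r) ·ᵛ ones w) k          ∎
    where
    open ≡-Reasoning
    b′ = bᵢ t l w (r * 2)
    transfer-A : ∀ k k′ → transfer t (suc (r * 2)) k k′ ≡ A k k′
    transfer-A k k′ =
      trans (subst (λ a → transfer t a k k′ ≡ transfer t 1 k k′) (ℕ.+-comm (r * 2) 1)
              (transfer-+*2 t 1 r k k′))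
            (transfer-1 k k′)

  bᵢ-last : 2 ≤ l → let X = (B · A) ^ᴹ ⌊ l ∸ 1 /2⌋ in
            (¬ 2 ∣ l → bᵢ t l w (l ∸ 1) ≗ X ·ᵛ ones w) ×
            (2 ∣ l → bᵢ t l w (l ∸ 1) ≗ A ·ᵛ X ·ᵛ ones w)
  bᵢ-last (s≤s {n = n} _) = odd , even
    where
    odd : ¬ 2 ∣ suc n → bᵢ t l w n ≗ ((B · A) ^ᴹ ⌊ n /2⌋) ·ᵛ ones w
    -- The last column has index `l` minus 1, so odd `l` calls for the formula for even columns, and
    -- vice versa.
    odd 2∤l with divides r refl ← odd-suc⇒even n 2∤l =
      subst (λ ρ → bᵢ t l w (r * 2) ≗ ((B · A) ^ᴹ ρ) ·ᵛ ones w)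
        (sym (⌊n*2/2⌋ r)) (bᵢ-even r (ℕ.n<1+n _))

    even : 2 ∣ suc n → bᵢ t l w n ≗ A ·ᵛ ((B · A) ^ᴹ ⌊ n /2⌋) ·ᵛ ones w
    even (divides (suc r) refl) =
      subst (λ ρ → bᵢ t l w (suc (r * 2)) ≗ A ·ᵛ ((B · A) ^ᴹ ρ) ·ᵛ ones w)
        (sym (⌊1+n*2/2⌋ r)) (bᵢ-odd r (ℕ.n<1+n _))

theorem2p4 : ∀ (l w : ℕ) → 2 ≤ l → (2≤w : 2 ≤ w) (2∣w : 2 ∣ w) →
  let u  = ones w
      b₀ = ones w
      ρ  = ⌊ l ∸ 1 /2⌋
      M₊ = Defs.M₊ w 2∣w
      M₋ = Defs.M₋ w 2≤w 2∣w
  in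
  ( 𝓑 first l w ≡ u ∙ bᵢ first l w (l ∸ 1)
  × (¬ 2 ∣ l → bᵢ first l w (l ∸ 1) ≗ ((M₊ · M₋) ^ᴹ ρ) ·ᵛ b₀)
  × (2 ∣ l → bᵢ first l w (l ∸ 1) ≗ M₋ ·ᵛ ((M₊ · M₋) ^ᴹ ρ) ·ᵛ b₀) )
  ×
  ( 𝓑 second l w ≡ u ∙ bᵢ second l w (l ∸ 1)
  × (¬ 2 ∣ l → bᵢ second l w (l ∸ 1) ≗ ((M₋ · M₊) ^ᴹ ρ) ·ᵛ b₀)
  × (2 ∣ l → bᵢ second l w (l ∸ 1) ≗ M₊ ·ᵛ ((M₋ · M₊) ^ᴹ ρ) ·ᵛ b₀) )
theorem2p4 l w 2≤l 2≤w 2∣w =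
  (𝓑-sum first l w , bᵢ-last first M₋-first M₊-first 2≤l) ,
  (𝓑-sum second l w , bᵢ-last second M₊-second M₋-second 2≤l)
  where
  M₋-first : ∀ k k′ → transfer first 1 k k′ ≡ Defs.M₋ w 2≤w 2∣w k k′
  M₋-first = reflected-M₋ 2≤w 2∣w

  M₊-first : ∀ k k′ → transfer first 0 k k′ ≡ Defs.M₊ w 2∣w k k′
  M₊-first = reflected-M₊ 2∣w

  M₊-second : ∀ k k′ → transfer second 1 k k′ ≡ Defs.M₊ w 2∣w k k′
  M₊-second k k′ =
    -- Here offset and column index add up to 2, which raises both halves by one.
    trans (sym (indicator-suc ⌊ height k′ /2⌋ ⌊ height k /2⌋)) (reflected-M₊ 2∣w k k′)

  M₋-second : ∀ k k′ → transfer second 0 k k′ ≡ Defs.M₋ w 2≤w 2∣w k k′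
  M₋-second = reflected-M₋ 2≤w 2∣w
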